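{- There is a graph with treewidth $2$ and local queue number $3$.
   Context: Graphs are finite, simple and undirected. Given a linear ordering $\prec$ of the vertex set of a graph, two edges $uv$ and $xy$ nest if $u \prec x \prec y \prec v$ or $x \prec u \prec v \prec y$ (for the endpoints named suitably). A queue is a set of edges no two of which nest. A queue layout of $G$ consists of a linear ordering $\prec$ of $V(G)$ and a partition of $E(G)$ into queues; it is $\ell$-local if every vertex has incident edges in at most $\ell$ queues (the total number of queues being arbitrary). The local queue number of $G$ is the smallest $\ell$ such that $G$ has an $\ell$-local queue layout. -}

module Defs where

open import Data.Bool using (Bool; T; T?)
open import Data.Fin using (Fin; zero; suc; inject₁; fromℕ)
open import Data.Fin.Subset using (Subset; _∈_; ∣_∣; ⊥; ⁅_⁆; ⋃)
open import Data.List using (map; allFin)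
open import Data.Nat using (ℕ; zero; suc; pred; _≤_; _⊔_; NonZero)
open import Data.Product using (Σ; ∃; _×_)
open import Data.Sum using (_⊎_)
open import Data.Vec.Functional using (foldr)
open import Function.Definitions using (Injective)
open import Level using (0ℓ)
open import Relation.Binary.Construct.Closure.ReflexiveTransitive using (Star)
open import Relation.Binary.Core using (Rel)
open import Relation.Binary.Structures using (IsStrictTotalOrder)
open import Relation.Binary.PropositionalEquality using (_≡_; _≢_)
open import Relation.Nullary using (¬_; yes; no)
open import Relation.Unary using (Pred)

IsLeast : ∀ {a} → Pred ℕ a → Pred ℕ a
IsLeast P k = P k × (∀ j → P j → k ≤ j)

record Graph (n : ℕ) : Set where
  field
    adj    : Fin n → Fin n → Bool
    sym    : ∀ u v → T (adj u v) → T (adj v u)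
    irrefl : ∀ v → ¬ T (adj v v)

  _~_ : Rel (Fin n) 0ℓ
  u ~ v = T (adj u v)

module _ {n : ℕ} (G : Graph n) where
  open Graph G

  Connected : Set
  Connected = ∀ u v → Star _~_ u v

  -- A cycle of length 3 + k through the distinct vertices c 0, …, c (2 + k).
  record Cycle : Set where
    field
      k         : ℕ
      c         : Fin (suc (suc (suc k))) → Fin n
      injective : Injective _≡_ _≡_ c
      step      : ∀ i → c (inject₁ i) ~ c (suc i)
      close     : c (fromℕ (suc (suc k))) ~ c zero

  record IsTree : Set where
    field
      nonEmpty  : NonZero n
      connected : Connected
      acyclic   : ¬ Cycle

record TreeDecomposition {n : ℕ} (G : Graph n) : Set where
  open Graph G
  field
    m      : ℕ
    tree   : Graph m
    isTree : IsTree tree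
    bag    : Fin m → Subset n

  open Graph tree using () renaming (_~_ to _~ₜ_)

  field
    coversVertex : ∀ v → ∃ λ t → v ∈ bag t
    coversEdge   : ∀ u v → u ~ v → ∃ λ t → u ∈ bag t × v ∈ bag t
    -- The nodes whose bags contain v induce a connected subgraph of the tree.
    subtree      : ∀ v s t → v ∈ bag s → v ∈ bag t →
                   Star (λ x y → x ~ₜ y × v ∈ bag x × v ∈ bag y) s t

  -- Truncated predecessor: a graph without vertices gets width 0 rather than -1.
  width : ℕ
  width = pred (foldr _⊔_ 0 (λ t → ∣ bag t ∣))

Treewidth : ∀ {n} → Graph n → ℕ → Set
Treewidth G = IsLeast (λ w → Σ (TreeDecomposition G) λ D → TreeDecomposition.width D ≡ w)

Nest : ∀ {n} → Rel (Fin n) 0ℓ → (u v x y : Fin n) → Set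
Nest _≺_ u v x y = (u ≺ x × x ≺ y × y ≺ v) ⊎ (x ≺ u × u ≺ v × v ≺ y)

record QueueLayout {n : ℕ} (G : Graph n) : Set₁ where
  open Graph G
  field
    _≺_                : Rel (Fin n) 0ℓ
    isStrictTotalOrder : IsStrictTotalOrder _≡_ _≺_
    -- The partition of the edges, as a map to queue labels. Labels may be
    -- unused; they do not affect locality, which counts only incident queues.
    queues             : ℕ
    queue              : ∀ u v → u ~ v → Fin queues
    queue-sym          : ∀ u v (e : u ~ v) → queue u v e ≡ queue v u (sym u v e)
    -- Every edge is met as both u v and v u, so all namings of the endpoints
    -- are covered.
    nonNesting         : ∀ u v x y (e : u ~ v) (f : x ~ y) →
                         Nest _≺_ u v x y → queue u v e ≢ queue x y f

  queueAlong : Fin n → Fin n → Subset queues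
  queueAlong v w with T? (adj v w)
  ... | yes e = ⁅ queue v w e ⁆
  ... | no  _ = ⊥

  queuesAt : Fin n → Subset queues
  queuesAt v = ⋃ (map (queueAlong v) (allFin n))

  IsLocal : ℕ → Set
  IsLocal ℓ = ∀ v → ∣ queuesAt v ∣ ≤ ℓ

LocalQueueNumber : ∀ {n} → Graph n → ℕ → Set₁
LocalQueueNumber G = IsLeast (λ ℓ → Σ (QueueLayout G) λ L → QueueLayout.IsLocal L ℓ)

{-# OPTIONS --safe #-}
module Submission where

-- Three queues suffice: build the graph by attaching each new vertex to an edge uv and put every
-- edge into a queue named after its older endpoint. Each queue is a star, and a vertex meets only
-- its own star and those of u and v.
--
-- Two do not, once every edge has many common neighbours ("children"), and so do the edges to
-- these, six levels deep. In a 2-local layout the queue of a child edge at u is either that of uv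
-- or the one other queue at u. So among many children of uv three are alike: they lie in the same
-- gap between the vertices considered so far and agree on the queues of their edges to u and to v.
-- This turns the layout into a finite game: a player names an edge, the layout answers with the gap
-- and the queues of three alike children, and it loses as soon as two edges in a queue nest or a
-- vertex meets three queues. An explicit strategy wins within six rounds, by evaluation.

import Algebra.Construct.NaturalChoice.Max as Max
open import Data.Bool using (Bool; true; false; not; _∧_; _∨_; if_then_else_; T; T?)
open import Data.Bool.ListAction using (any)
open import Data.Bool.Properties using (T-∧; T-∨; T-irrelevant; ∧-conicalˡ; ∧-conicalʳ)
open import Data.Fin as Fin using (Fin; zero; suc; toℕ; inject₁; fromℕ; combine; join; splitAt)
open import Data.Fin.Properties as Fin
  using (any?; pigeonhole; combine-injective; splitAt-join; toℕ<n; toℕ-inject₁)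
open import Data.Fin.Relation.Unary.Top using (View; view; ‵fromℕ; ‵inject₁)
open import Data.Fin.Subset
  using (Subset; inside; outside; ⊤; _∈_; _∉_; _⊆_; _∪_; _-_; ∣_∣; ⋃; ⁅_⁆)
open import Data.Fin.Subset.Properties
open import Data.List
  using (List; []; _∷_; [_]; _++_; map; filterᵇ; concatMap; upTo; drop; take; allFin)
open import Data.List.Membership.Propositional using (find) renaming (_∈_ to _∈ₗ_)
open import Data.List.Membership.Propositional.Properties
  using (∈-map⁺; ∈-map⁻; ∈-filter⁺; ∈-filter⁻; ∈-concatMap⁺; ∈-upTo⁺; ∈-upTo⁻; ∈-allFin)
open import Data.List.Relation.Unary.All as All using (All)
import Data.List.Relation.Unary.All.Properties as All
open import Data.List.Relation.Unary.Any as Any using (here; there)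
open import Data.List.Relation.Unary.Any.Properties using (any⁻)
open import Data.Nat
  using (ℕ; zero; suc; _+_; _*_; _⊔_; _≤_; _<_; _<ᵇ_; _≡ᵇ_; z≤n; s≤s; z<s; s<s; s≤s⁻¹; s<s⁻¹)
open import Data.Nat.Properties
open import Data.Product as Product using (Σ; ∃; ∃₂; _×_; _,_; proj₁; proj₂)
open import Data.Sum as Sum using (_⊎_; inj₁; inj₂; [_,_]′)
open import Data.Unit using (tt)
open import Data.Vec.Base as Vec using (here; there)
open import Data.Vec.Functional using (foldr)
open import Function using (_∘_; id; Injective)
open import Function.Bundles using (Equivalence)
open import Level using (0ℓ)
open import Relation.Binary.Construct.Closure.ReflexiveTransitive as Star
  using (Star; ε; _◅_; _◅◅_)
open import Relation.Binary.Core using (Rel)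
open import Relation.Binary.Definitions using (tri<; tri≈; tri>)
open import Relation.Binary.PropositionalEquality hiding ([_])
open import Relation.Binary.Structures using (IsStrictTotalOrder)
open import Relation.Nullary using (¬_; yes; no; does; contradiction)

open import Defs

private variable
  A   : Set
  n o : ℕ
  G H : Graph n

-- Finite subsets

three-in-subset : ∀ {p : Subset n} {a b c} → a ∈ p → b ∈ p → c ∈ p →
                  a ≢ b → a ≢ c → b ≢ c → 3 ≤ ∣ p ∣
three-in-subset {p = p} {a} {b} {c} a∈ b∈ c∈ a≢b a≢c b≢c =
  ≤-<-trans (≤-<-trans (≤-<-trans z≤n (x∈p⇒∣p-x∣<∣p∣ c∈p-a-b)) (x∈p⇒∣p-x∣<∣p∣ b∈p-a))
            (x∈p⇒∣p-x∣<∣p∣ a∈)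
  where
  b∈p-a : b ∈ p - a
  b∈p-a = x∈p∧x≢y⇒x∈p-y b∈ (a≢b ∘ sym)
  c∈p-a-b : c ∈ (p - a) - b
  c∈p-a-b = x∈p∧x≢y⇒x∈p-y (x∈p∧x≢y⇒x∈p-y c∈ (a≢c ∘ sym)) (b≢c ∘ sym)

∣p∪q∣≤∣p∣+∣q∣ : ∀ (p q : Subset n) → ∣ p ∪ q ∣ ≤ ∣ p ∣ + ∣ q ∣
∣p∪q∣≤∣p∣+∣q∣ Vec.[] Vec.[] = z≤n
∣p∪q∣≤∣p∣+∣q∣ (true Vec.∷ p) (true Vec.∷ q) = 
  s≤s (≤-trans (∣p∪q∣≤∣p∣+∣q∣ p q) (+-monoʳ-≤ ∣ p ∣ (n≤1+n _)))
∣p∪q∣≤∣p∣+∣q∣ (true Vec.∷ p) (false Vec.∷ q) = s≤s (∣p∪q∣≤∣p∣+∣q∣ p q)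
∣p∪q∣≤∣p∣+∣q∣ (false Vec.∷ p) (true Vec.∷ q) = 
  ≤-trans (s≤s (∣p∪q∣≤∣p∣+∣q∣ p q)) (≤-reflexive (sym (+-suc ∣ p ∣ ∣ q ∣)))
∣p∪q∣≤∣p∣+∣q∣ (false Vec.∷ p) (false Vec.∷ q) = ∣p∪q∣≤∣p∣+∣q∣ p q

∣pair∣≤2 : ∀ (u v : Fin n) → ∣ ⁅ u ⁆ ∪ ⁅ v ⁆ ∣ ≤ 2
∣pair∣≤2 u v =
  ≤-trans (∣p∪q∣≤∣p∣+∣q∣ ⁅ u ⁆ ⁅ v ⁆) (≤-reflexive (cong₂ _+_ (∣⁅x⁆∣≡1 u) (∣⁅x⁆∣≡1 v)))

pair⁺ : ∀ {u v x : Fin n} → x ≡ u ⊎ x ≡ v → x ∈ ⁅ u ⁆ ∪ ⁅ v ⁆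
pair⁺ = x∈p∪q⁺ ∘ Sum.map (λ { refl → x∈⁅x⁆ _ }) (λ { refl → x∈⁅x⁆ _ })

pair⁻ : ∀ (u v : Fin n) {x} → x ∈ ⁅ u ⁆ ∪ ⁅ v ⁆ → x ≡ u ⊎ x ≡ v
pair⁻ u v = Sum.map (x∈⁅y⁆⇒x≡y u) (x∈⁅y⁆⇒x≡y v) ∘ x∈p∪q⁻ ⁅ u ⁆ ⁅ v ⁆

⋃⁺ : ∀ {x : Fin n} {p} {ps} → x ∈ p → p ∈ₗ ps → x ∈ ⋃ ps
⋃⁺ x∈p (here refl) = x∈p∪q⁺ (inj₁ x∈p)
⋃⁺ x∈p (there p∈)  = x∈p∪q⁺ (inj₂ (⋃⁺ x∈p p∈))

⋃-lub : ∀ {q : Subset n} {ps} → All (_⊆ q) ps → ⋃ ps ⊆ q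
⋃-lub All.[]           x∈ = contradiction x∈ ∉⊥
⋃-lub (p⊆q All.∷ ps⊆q) x∈ = [ p⊆q , ⋃-lub ps⊆q ]′ (x∈p∪q⁻ _ _ x∈)

-- Two-trees

either : Fin n → Fin n → Fin n → Bool
either u v x = does (x Fin.≟ u) ∨ does (x Fin.≟ v)

either⁻ : ∀ (u v x : Fin n) → T (either u v x) → x ≡ u ⊎ x ≡ v
either⁻ u v x t with x Fin.≟ u | x Fin.≟ v
... | yes x≡u | _       = inj₁ x≡u
... | no  _   | yes x≡v = inj₂ x≡v

either⁺ˡ : ∀ (u v : Fin n) → T (either u v u)
either⁺ˡ u v with u Fin.≟ u
... | yes _  = tt
... | no u≢u = contradiction refl u≢u

either⁺ʳ : ∀ (u v : Fin n) → T (either u v v)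
either⁺ʳ u v with v Fin.≟ u | v Fin.≟ v
... | yes _ | _      = tt
... | no  _ | yes _  = tt
... | no  _ | no v≢v = contradiction refl v≢v

-- The new vertex is `zero` and all others move up, so a larger number means an older vertex.
stack : Graph n → Fin n → Fin n → Graph (suc n)
stack {n} G u v = record
  { adj    = adj
  ; sym    = λ { zero (suc _) t → t ; (suc _) zero t → t ; (suc x) (suc y) → Graph.sym G x y }
  ; irrefl = λ { (suc x) → Graph.irrefl G x }
  }
  where
  adj : Fin (suc n) → Fin (suc n) → Bool
  adj zero    zero    = false
  adj zero    (suc x) = either u v x
  adj (suc x) zero    = either u v x
  adj (suc x) (suc y) = Graph.adj G x y

K₁ : Graph 1
K₁ = record { adj = λ _ _ → false ; sym = λ _ _ () ; irrefl = λ _ () }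

-- Attaching at u = v adds a leaf, which turns the single vertex into an edge.
data TwoTree : ∀ {n} → Graph n → Set where
  single : TwoTree K₁
  attach : ∀ {n} {G : Graph n} {u v} → TwoTree G → u ≡ v ⊎ Graph._~_ G u v →
           TwoTree (stack G u v)

-- Three-local layouts

-- Larger neighbours are older, so `p` and `q` are the vertices to which `v` was attached; for the
-- initial vertex they are arbitrary.
parents : TwoTree G → ∀ v → ∃₂ λ p q → ∀ w → Graph._~_ G v w → v Fin.< w → w ≡ p ⊎ w ≡ q
parents single v = v , v , λ _ ()
parents (attach {u = u} {v} T _) zero = suc u , suc v ,
  λ { (suc w) e _ → Sum.map (cong suc) (cong suc) (either⁻ u v w e) }
parents (attach T _) (suc v) with parents T v
... | p , q , later = suc p , suc q ,
  λ { (suc w) e v<w → Sum.map (cong suc) (cong suc) (later w e (s<s⁻¹ v<w)) }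

module Maxᶠ {n : ℕ} = Max (Fin.≤-totalOrder n)
open Maxᶠ using () renaming (_⊔_ to _⊔ᶠ_)

-- The queue of an edge is its older endpoint, so every queue is a star.
starLayout : (G : Graph n) → QueueLayout G
starLayout {n} G = record
  { _≺_                = Fin._<_
  ; isStrictTotalOrder = Fin.<-isStrictTotalOrder
  ; queues             = n
  ; queue              = λ u v _ → u ⊔ᶠ v
  ; queue-sym          = λ u v _ → Maxᶠ.⊔-comm u v
  ; nonNesting         = λ
    { u v x y _ _ (inj₁ (u<x , x<y , y<v)) →
        ordered (Fin.<-trans u<x (Fin.<-trans x<y y<v)) x<y (Fin.<⇒≢ y<v ∘ sym)
    ; u v x y _ _ (inj₂ (x<u , u<v , v<y)) →
        ordered u<v (Fin.<-trans x<u (Fin.<-trans u<v v<y)) (Fin.<⇒≢ v<y)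
    }
  }
  where
  ordered : ∀ {u v x y : Fin n} → u Fin.< v → x Fin.< y → v ≢ y → u ⊔ᶠ v ≢ x ⊔ᶠ y
  ordered u<v x<y v≢y eq = v≢y
    (trans (sym (Maxᶠ.x≤y⇒x⊔y≈y (<⇒≤ u<v))) (trans eq (Maxᶠ.x≤y⇒x⊔y≈y (<⇒≤ x<y))))

starLayout-local : TwoTree G → QueueLayout.IsLocal (starLayout G) 3
starLayout-local {n} {G} T v with parents T v
... | p , q , later = ≤-trans (p⊆q⇒∣p∣≤∣q∣ queuesAt⊆)
  (≤-trans (∣p∪q∣≤∣p∣+∣q∣ ⁅ v ⁆ (⁅ p ⁆ ∪ ⁅ q ⁆))
           (+-mono-≤ (≤-reflexive (∣⁅x⁆∣≡1 v)) (∣pair∣≤2 p q)))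
  where
  open QueueLayout (starLayout G)

  along⊆ : ∀ w → queueAlong v w ⊆ ⁅ v ⁆ ∪ (⁅ p ⁆ ∪ ⁅ q ⁆)
  along⊆ w x∈ with T? (Graph.adj G v w)
  ... | no  _ = contradiction x∈ ∉⊥
  ... | yes e with x∈⁅y⁆⇒x≡y (v ⊔ᶠ w) x∈ | Fin.≤-total w v
  -- A smaller `w` puts the edge into the star of `v` itself; a larger `w` is `p` or `q`.
  ... | refl | inj₁ w≤v = x∈p∪q⁺ (inj₁ (subst (_∈ ⁅ v ⁆) (sym (Maxᶠ.x≤y⇒y⊔x≈y w≤v)) (x∈⁅x⁆ v)))
  ... | refl | inj₂ v≤w = x∈p∪q⁺ (inj₂ (subst (_∈ ⁅ p ⁆ ∪ ⁅ q ⁆) (sym (Maxᶠ.x≤y⇒x⊔y≈y v≤w))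
    (pair⁺ (later w e (Fin.≤∧≢⇒< v≤w λ { refl → Graph.irrefl G v e })))))

  queuesAt⊆ : queuesAt v ⊆ ⁅ v ⁆ ∪ (⁅ p ⁆ ∪ ⁅ q ⁆)
  queuesAt⊆ = ⋃-lub (All.map⁺ (All.universal along⊆ (allFin n)))

-- Treewidth

module _ {T : Graph n} (t : Fin n) where
  open Graph (stack T t t) using (_~_)

  leaf-neighbour : ∀ {x} → zero ~ x → x ≡ suc t
  leaf-neighbour {suc x} e with either⁻ t t x e
  ... | inj₁ refl = refl
  ... | inj₂ refl = refl

  leaf-connected : Connected T → Connected (stack T t t)
  leaf-connected conn zero    zero    = ε
  leaf-connected conn zero    (suc y) = either⁺ˡ t t ◅ Star.gmap suc id (conn t y)
  leaf-connected conn (suc x) zero    = Star.gmap suc id (conn x t) ◅◅ (either⁺ˡ t t ◅ ε)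
  leaf-connected conn (suc x) (suc y) = Star.gmap suc id (conn x y)

  -- A vertex of a cycle has two distinct neighbours there.
  leaf-off-cycle : (C : Cycle (stack T t t)) → ∀ i → Cycle.c C i ≢ zero
  leaf-off-cycle C i eq = by-view (view i) eq
    where
    open Cycle C
    at-leaf : ∀ {i j} → c i ≡ zero → c i ~ c j → c j ≡ suc t
    at-leaf {j = j} eq e = leaf-neighbour (subst (_~ c j) eq e)
    ~-sym : ∀ {i j} → c i ~ c j → c j ~ c i
    ~-sym {i} {j} = Graph.sym (stack T t t) (c i) (c j)
    absurd : ∀ {i j l} → c i ≡ zero → c i ~ c j → c i ~ c l → j ≡ l
    absurd eq e e′ = injective (trans (at-leaf eq e) (sym (at-leaf eq e′)))
    by-view : ∀ {i} → View i → c i ≢ zero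
    by-view ‵fromℕ eq = contradiction (absurd eq close (~-sym (step (fromℕ (suc k))))) λ ()
    by-view (‵inject₁ zero) eq = contradiction (absurd eq (step zero) (~-sym close)) λ ()
    -- The two neighbours on the cycle have the indices `l` and `l + 2`.
    by-view (‵inject₁ (suc l)) eq = <⇒≢ (m≤n⇒m≤1+n ≤-refl)
      (trans (sym (trans (toℕ-inject₁ (inject₁ l)) (toℕ-inject₁ l)))
        (cong toℕ (sym (absurd eq (step (suc l)) (~-sym (step (inject₁ l)))))))

  leaf-acyclic : ¬ Cycle T → ¬ Cycle (stack T t t)
  leaf-acyclic acyclic C = acyclic record
    { k = k
    ; c = c′
    ; injective = λ eq → injective (trans (suc-c′ _) (trans (cong suc eq) (sym (suc-c′ _))))
    ; step = λ i → subst₂ _~_ (suc-c′ _) (suc-c′ _) (step i)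
    ; close = subst₂ _~_ (suc-c′ _) (suc-c′ _) close
    }
    where
    open Cycle C
    c″ : ∀ i → ∃ λ x → c i ≡ suc x
    c″ i with c i in eq
    ... | zero  = contradiction eq (leaf-off-cycle C i)
    ... | suc x = x , refl
    c′ = proj₁ ∘ c″
    suc-c′ : ∀ i → c i ≡ suc (c′ i)
    suc-c′ = proj₂ ∘ c″

  leaf-tree : IsTree T → IsTree (stack T t t)
  leaf-tree tree = record
    { connected = leaf-connected (IsTree.connected tree)
    ; acyclic   = leaf-acyclic (IsTree.acyclic tree)
    }

K₁-tree : IsTree K₁
K₁-tree = record { connected = λ { zero zero → ε } ; acyclic = λ C → Cycle.close C }

module _ {G : Graph n} (D : TreeDecomposition G) {u v : Fin n} where
  open TreeDecomposition D

  -- The bag of the new vertex, `u` and `v` hangs as a leaf on `t`. As `u` and `v` lie in the bag of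
  -- `t`, their subtrees stay connected.
  attach-decomposition : ∀ t → u ∈ bag t → v ∈ bag t → TreeDecomposition (stack G u v)
  attach-decomposition t u∈ v∈ = record
    { m            = suc m
    ; tree         = stack tree t t
    ; isTree       = leaf-tree t isTree
    ; bag          = bag′
    ; coversVertex = λ { zero → zero , here ; (suc x) → Product.map suc there (coversVertex x) }
    ; coversEdge   = λ
      { zero    (suc x) e → zero , here , there (pair⁺ (either⁻ u v x e))
      ; (suc x) zero    e → zero , there (pair⁺ (either⁻ u v x e)) , here
      ; (suc x) (suc y) e → Product.map suc (Product.map there there) (coversEdge x y e)
      }
    ; subtree      = λ
      { zero    zero    zero    _          _          → ε
      ; (suc x) zero    zero    _          _          → ε
      ; (suc x) zero    (suc r) (there x∈) (there x∈′) → down x∈ ◅ old x _ _ (in-bag x∈) x∈′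
      ; (suc x) (suc s) zero    (there x∈) (there x∈′) → old x _ _ x∈ (in-bag x∈′) ◅◅ (up x∈′ ◅ ε)
      ; (suc x) (suc s) (suc t) (there x∈) (there x∈′) → old x s t x∈ x∈′
      }
    }
    where
    bag′ : Fin (suc m) → Subset (suc n)
    bag′ zero    = inside Vec.∷ (⁅ u ⁆ ∪ ⁅ v ⁆)
    bag′ (suc s) = outside Vec.∷ bag s

    Step : Fin (suc n) → Fin (suc m) → Fin (suc m) → Set
    Step x r s = Graph._~_ (stack tree t t) r s × x ∈ bag′ r × x ∈ bag′ s

    in-bag : ∀ {x} → x ∈ ⁅ u ⁆ ∪ ⁅ v ⁆ → x ∈ bag t
    in-bag x∈ with pair⁻ u v x∈
    ... | inj₁ refl = u∈
    ... | inj₂ refl = v∈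

    down : ∀ {x} → x ∈ ⁅ u ⁆ ∪ ⁅ v ⁆ → Step (suc x) zero (suc t)
    down x∈ = either⁺ˡ t t , there x∈ , there (in-bag x∈)
    up : ∀ {x} → x ∈ ⁅ u ⁆ ∪ ⁅ v ⁆ → Step (suc x) (suc t) zero
    up x∈ = either⁺ˡ t t , there (in-bag x∈) , there x∈

    old : ∀ x r s → x ∈ bag r → x ∈ bag s → Star (Step (suc x)) (suc r) (suc s)
    old x r s x∈ x∈′ = Star.gmap suc (Product.map₂ (Product.map there there)) (subtree x r s x∈ x∈′)

decompose : TwoTree G → Σ (TreeDecomposition G) λ D → ∀ t → ∣ TreeDecomposition.bag D t ∣ ≤ 3
decompose single = record
  { m            = 1
  ; tree         = K₁
  ; isTree       = K₁-tree
  ; bag          = λ _ → ⊤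
  ; coversVertex = λ _ → zero , ∈⊤
  ; coversEdge   = λ _ _ ()
  ; subtree      = λ { _ zero zero _ _ → ε }
  } , λ _ → s≤s z≤n
decompose (attach {u = u} {v} T uv) with decompose T
... | D , small = attach-decomposition D (proj₁ node) (proj₁ (proj₂ node)) (proj₂ (proj₂ node)) ,
  λ { zero → s≤s (∣pair∣≤2 u v) ; (suc t) → small t }
  where
  open TreeDecomposition D
  node : ∃ λ t → u ∈ bag t × v ∈ bag t
  -- If `u` and `v` coincide, any node containing `u` will do; otherwise one that covers the edge.
  node = [ (λ { refl → Product.map₂ (λ u∈ → u∈ , u∈) (coversVertex u) }) , coversEdge u v ]′ uv

foldr-⊔-lub : ∀ {m b} (f : Fin m → ℕ) → (∀ t → f t ≤ b) → foldr _⊔_ 0 f ≤ b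
foldr-⊔-lub {zero}  f f≤ = z≤n
foldr-⊔-lub {suc m} f f≤ = ⊔-lub (f≤ zero) (foldr-⊔-lub (f ∘ suc) (f≤ ∘ suc))

f≤foldr-⊔ : ∀ {m} (f : Fin m → ℕ) t → f t ≤ foldr _⊔_ 0 f
f≤foldr-⊔ f zero    = m≤m⊔n _ _
f≤foldr-⊔ f (suc t) = ≤-trans (f≤foldr-⊔ (f ∘ suc) t) (m≤n⊔m (f zero) _)

-- Paths, bridges and triangles in tree decompositions

record Path {A : Set} (R : Rel A 0ℓ) (x y : A) : Set where
  field
    length    : ℕ
    at        : Fin (suc length) → A
    injective : Injective _≡_ _≡_ at
    start     : at zero ≡ x
    end       : at (fromℕ length) ≡ y
    step      : ∀ i → R (at (inject₁ i)) (at (suc i))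

module _ {R : Rel (Fin o) 0ℓ} where
  open Path

  suffix : ∀ {x y} (P : Path R x y) i → Path R (at P i) y
  suffix P zero    = record { Path P ; start = refl }
  suffix record { length = suc l ; at = at ; injective = inj ; end = end ; step = step } (suc i) =
    suffix record { length = l ; at = at ∘ suc ; injective = Fin.suc-injective ∘ inj ; start = refl
                  ; end = end ; step = step ∘ suc } i

  -- If `x` occurs on the path already obtained from the rest of the walk, the part from there on
  -- suffices; otherwise `x` can be put in front.
  loop-erase : ∀ {x y} → Star R x y → Path R x y
  loop-erase {x} ε = record { length = 0 ; at = λ _ → x ; injective = λ { {zero} {zero} _ → refl }
                            ; start = refl ; end = refl ; step = λ () }
  loop-erase {x} (r ◅ rs) with loop-erase rs
  ... | P with any? (λ i → at P i Fin.≟ x)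
  ... | yes (i , refl) = suffix P i
  ... | no  x∉P        = record
    { length = suc (length P)
    ; at = at′
    ; injective = λ { {zero} {zero} _ → refl ; {zero} {suc j} eq → contradiction (j , sym eq) x∉P
                    ; {suc i} {zero} eq → contradiction (i , eq) x∉P
                    ; {suc i} {suc j} eq → cong suc (injective P eq) }
    ; start = refl
    ; end = end P
    ; step = λ { zero → subst (R x) (sym (start P)) r ; (suc i) → step P i }
    }
    where
    at′ : Fin (suc (suc (length P))) → Fin _
    at′ zero    = x
    at′ (suc i) = at P i

module _ {T : Graph o} (acyclic : ¬ Cycle T) where
  open Graph T

  Avoiding : Fin o → Fin o → Rel (Fin o) 0ℓ
  Avoiding p q x y = x ~ y × ¬ ((x ≡ p × y ≡ q) ⊎ (x ≡ q × y ≡ p))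

  -- A loop-erased walk back from q to p has at least three vertices, and pq closes it to a cycle.
  bridge : ∀ {p q} → p ~ q → ¬ Star (Avoiding p q) q p
  bridge {p} {q} pq walk with loop-erase walk
  ... | record { length = zero ; start = refl ; end = refl } = irrefl _ pq
  ... | record { length = suc zero ; start = refl ; end = refl ; step = step } =
    proj₂ (step zero) (inj₂ (refl , refl))
  ... | record { length = suc (suc k) ; at = at ; injective = inj ; start = refl ; end = refl
             ; step = step } =
    acyclic record { k = k ; c = at ; injective = inj ; step = proj₁ ∘ step ; close = pq }

module _ {G : Graph n} (D : TreeDecomposition G) {u v w : Fin n} where
  open TreeDecomposition D
  open Graph tree using () renaming (_~_ to _~ₜ_)

  Common : Set
  Common = ∃ λ t → u ∈ bag t × v ∈ bag t × w ∈ bag t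

  OutsideV : Rel (Fin m) 0ℓ
  OutsideV s t = s ~ₜ t × v ∉ bag s × v ∉ bag t

  -- Where a walk through bags containing u leaves those containing v for good, its remainder and
  -- the subtrees of w and v lead back to the exit edge tt′. By acyclicity they use it, and only the
  -- subtree of w can, whence w lies in the bag of t.
  exit : ∀ {t b c} → u ∈ bag b → w ∈ bag b → v ∈ bag c → w ∈ bag c →
         Star (λ x y → x ~ₜ y × u ∈ bag x × u ∈ bag y) t b →
         Common ⊎ (v ∉ bag t × Star OutsideV t b)
  exit {b = b} u∈b w∈b v∈c w∈c ε with v ∈? bag b
  ... | yes v∈b = inj₁ (b , u∈b , v∈b , w∈b)
  ... | no  v∉b = inj₂ (v∉b , ε)
  exit {t} {b} {c} u∈b w∈b v∈c w∈c (_◅_ {j = t′} (tt′ , u∈t , u∈t′) rest)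
    with exit u∈b w∈b v∈c w∈c rest
  ... | inj₁ found = inj₁ found
  ... | inj₂ (v∉t′ , out) with v ∈? bag t | w ∈? bag t
  ... | no  v∉t | _       = inj₂ (v∉t , (tt′ , v∉t , v∉t′) ◅ out)
  ... | yes v∈t | yes w∈t = inj₁ (t , u∈t , v∈t , w∈t)
  ... | yes v∈t | no  w∉t = contradiction
    (Star.map (λ { (e , v∉x , v∉y) → e , λ
        { (inj₁ (refl , _)) → v∉x v∈t ; (inj₂ (_ , refl)) → v∉y v∈t } }) out
     ◅◅ Star.map (λ { (e , w∈x , w∈y) → e , λ
        { (inj₁ (refl , _)) → w∉t w∈x ; (inj₂ (_ , refl)) → w∉t w∈y } }) (subtree w b c w∈b w∈c)
     ◅◅ Star.map (λ { (e , v∈x , v∈y) → e , λ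
        { (inj₁ (_ , refl)) → v∉t′ v∈y ; (inj₂ (refl , _)) → v∉t′ v∈x } }) (subtree v c t v∈c v∈t))
    (bridge (IsTree.acyclic isTree) tt′)

  -- The Helly property for the subtrees of `u`, `v` and `w`. The walk through bags containing `u`
  -- starts at a bag that also contains `v`, which rules out the second outcome of `exit`.
  triangle-bag : Graph._~_ G u v → Graph._~_ G u w → Graph._~_ G v w → Common
  triangle-bag uv uw vw with coversEdge u v uv | coversEdge u w uw | coversEdge v w vw
  ... | a , u∈a , v∈a | b , u∈b , w∈b | c , v∈c , w∈c
    with exit u∈b w∈b v∈c w∈c (subtree u a b u∈a u∈b)
  ... | inj₁ found     = found
  ... | inj₂ (v∉a , _) = contradiction v∈a v∉a

  2≤width : Graph._~_ G u v → Graph._~_ G u w → Graph._~_ G v w → 2 ≤ width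
  2≤width uv uw vw with triangle-bag uv uw vw
  ... | t , u∈ , v∈ , w∈ = pred-mono-≤ (≤-trans
    (three-in-subset u∈ v∈ w∈ (distinct uv) (distinct uw) (distinct vw)) (f≤foldr-⊔ (∣_∣ ∘ bag) t))
    where
    distinct : ∀ {x y} → Graph._~_ G x y → x ≢ y
    distinct e refl = Graph.irrefl G _ e

-- Rich two-trees

-- The index counts the rounds that can be played from this edge: each round passes to children
-- whose edges are one level poorer.
data Rich (G : Graph n) (N : ℕ) : ℕ → Fin n → Fin n → Set where
  edge : ∀ {u v} → Graph._~_ G u v → Rich G N zero u v
  node : ∀ {d u v} → Graph._~_ G u v → (w : Fin N → Fin n) → Injective _≡_ _≡_ w →
         (∀ i → Rich G N d u (w i) × Rich G N d v (w i)) → Rich G N (suc d) u v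

module _ {G : Graph n} {N : ℕ} where
  open Graph G using (_~_)

  Rich⇒~ : ∀ {d u v} → Rich G N d u v → u ~ v
  Rich⇒~ (edge e)       = e
  Rich⇒~ (node e _ _ _) = e

  Rich-sym : ∀ {d u v} → Rich G N d u v → Rich G N d v u
  Rich-sym (edge e)         = edge (Graph.sym G _ _ e)
  Rich-sym (node e w inj r) = node (Graph.sym G _ _ e) w inj (Product.swap ∘ r)

  -- Lowers the old edges to the level of the new ones after a round, so that one depth serves for a
  -- whole state.
  Rich-pred : ∀ d {u v} → Rich G N (suc d) u v → Rich G N d u v
  Rich-pred zero    (node e _ _ _)   = edge e
  Rich-pred (suc d) (node e w inj r) =
    node e w inj λ i → Product.map (Rich-pred d) (Rich-pred d) (r i)

record _↪_ (G : Graph n) (H : Graph o) : Set where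
  field
    to        : Fin n → Fin o
    injective : Injective _≡_ _≡_ to
    preserves : ∀ {u v} → Graph._~_ G u v → Graph._~_ H (to u) (to v)
open _↪_ using (to; preserves) renaming (injective to to-injective)

↪-refl : G ↪ G
↪-refl = record { to = id ; injective = id ; preserves = id }

↪-trans : ∀ {k} {K : Graph k} → G ↪ H → H ↪ K → G ↪ K
↪-trans f g = record
  { to        = to g ∘ to f
  ; injective = to-injective f ∘ to-injective g
  ; preserves = preserves g ∘ preserves f
  }

↪-stack : ∀ {u v} → G ↪ stack G u v
↪-stack = record { to = suc ; injective = Fin.suc-injective ; preserves = id }

Rich-map : ∀ {N} d (f : G ↪ H) {u v} → Rich G N d u v → Rich H N d (to f u) (to f v)
Rich-map zero    f (edge e)         = edge (preserves f e)
Rich-map (suc d) f (node e w inj r) = node (preserves f e) (to f ∘ w) (inj ∘ to-injective f)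
  λ i → Product.map (Rich-map d f) (Rich-map d f) (r i)

-- Enriching an edge adds vertices, so a result is a larger two-tree with an embedding that tells
-- where the given edge has gone.
record Extension {n} (G : Graph n) (P : ∀ {m} {H : Graph m} → G ↪ H → Set) : Set where
  constructor extension
  field
    {order} : ℕ
    {graph} : Graph order
    twoTree : TwoTree graph
    embed   : G ↪ graph
    holds   : P embed

-- The number `c` of children present is kept apart from the number `N` wanted below them, so that
-- children can be added one by one.
RichChildren : ∀ (N d c : ℕ) (H : Graph o) → Fin o → Fin o → Set
RichChildren {o} N d c H u v = Graph._~_ H u v × Σ (Fin c → Fin o) λ w →
  Injective _≡_ _≡_ w × (∀ i → Rich H N d u (w i) × Rich H N d v (w i))

-- One more child is attached to the current graph, then its edge to `u` and its edge to `v` are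
-- enriched in turn. The children made before are carried along the embeddings.
enrich : ∀ N d {G : Graph n} {u v} → TwoTree G → Graph._~_ G u v →
         Extension G (λ {_} {H} f → Rich H N d (to f u) (to f v))
enrichChildren : ∀ N d c {G : Graph n} {u v} → TwoTree G → Graph._~_ G u v →
                 Extension G (λ {_} {H} f → RichChildren N d c H (to f u) (to f v))

enrich N zero    T e = extension T ↪-refl (edge e)
enrich N (suc d) T e with enrichChildren N d N T e
... | extension T′ f (e′ , w , inj , r) = extension T′ f (node e′ w inj r)

enrichChildren N d zero T e = extension T ↪-refl (e , (λ ()) , (λ { {()} }) , λ ())
enrichChildren {n} N d (suc c) {G} {u} {v} T e
  with enrichChildren N d c {u = u} {v} T e
... | extension T₁ f₁ (e₁ , w , w-inj , rich)
  with enrich N d (attach T₁ (inj₂ e₁)) (either⁺ˡ (to f₁ u) (to f₁ v))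
... | extension T₂ f₂ rich₂
  with enrich N d T₂ (preserves f₂ {suc (to f₁ v)} {zero} (either⁺ʳ (to f₁ u) (to f₁ v)))
... | extension {graph = K} T₃ f₃ rich₃ =
  extension T₃ (↪-trans f₁ g) (preserves g e₁ , w′ , w′-inj , rich′)
  where
  -- `h` starts from the graph with the new child attached, `g` from the graph before that.
  h = ↪-trans f₂ f₃
  g = ↪-trans ↪-stack h

  w′ : Fin (suc c) → Fin _
  w′ zero    = to h zero
  w′ (suc i) = to g (w i)

  w′-inj : Injective _≡_ _≡_ w′
  w′-inj {zero}  {zero}  _  = refl
  w′-inj {zero}  {suc j} eq = contradiction (to-injective h eq) λ ()
  w′-inj {suc i} {zero}  eq = contradiction (to-injective h eq) λ ()
  w′-inj {suc i} {suc j} eq = cong suc (w-inj (to-injective g eq))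

  rich′ : ∀ i → Rich K N d (to g (to f₁ u)) (w′ i) × Rich K N d (to g (to f₁ v)) (w′ i)
  rich′ zero    = Rich-map d f₃ rich₂ , rich₃
  rich′ (suc i) = Product.map (Rich-map d g) (Rich-map d g) (rich i)

-- The game

-- Vertices and queues are numbered, the vertices by their position in the layout. An arc joins the
-- vertices lo < hi by an edge in the queue colour.
record Arc : Set where
  constructor arc
  field
    lo hi colour : ℕ
open Arc

record State : Set where
  constructor state
  field
    size colours : ℕ
    arcs         : List Arc
open State

clashes : Arc → Arc → Bool
clashes e f = (colour e ≡ᵇ colour f) ∧ (encloses e f ∨ encloses f e)
  where
  encloses : Arc → Arc → Bool
  -- The last test supplies the middle inequality of `Nest`, as `Drawn` does not record that `lo` is
  -- below `hi`.
  encloses e f = (lo e <ᵇ lo f) ∧ (hi f <ᵇ hi e) ∧ (lo f <ᵇ hi f)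

-- The first six arcs are those at the three newest vertices; older arcs are compared already.
nested : State → Bool
nested s = any (λ e → any (clashes e) (arcs s)) (take 6 (arcs s))

-- Giving the colour α to another arc at x would bring the number of colours there above two.
crowded : List Arc → ℕ → ℕ → Bool
crowded es x α = any (λ a → any (λ b → not (a ≡ᵇ b) ∧ not (a ≡ᵇ α) ∧ not (b ≡ᵇ α)) cs) cs
  where
  cs : List ℕ
  cs = map colour (filterᵇ (λ e → (lo e ≡ᵇ x) ∨ (hi e ≡ᵇ x)) es)

-- The new vertices take the numbers g, g + 1, g + 2, and those from g on move up by three.
spoke : ℕ → ℕ → ℕ → ℕ → Arc
spoke g u α j = if u <ᵇ g then arc u (j + g) α else arc (j + g) (3 + u) α

shift : ℕ → ℕ → ℕ
shift g u = if u <ᵇ g then u else 3 + u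

child : State → Arc → ℕ → ℕ → ℕ → State
child (state k K es) (arc u v _) α β g = state (3 + k) ((K ⊔ suc α) ⊔ suc β)
  (map (spoke g u α) (upTo 3) ++ map (spoke g v β) (upTo 3) ++
   map (λ e → arc (shift g (lo e)) (shift g (hi e)) (colour e)) es)

-- The colour K is the first unused one.
colourings : List Arc → ℕ → ℕ → List ℕ
colourings es x K = filterᵇ (λ α → not (crowded es x α)) (upTo (suc K))

-- Only the ends of `e` are tested for crowding, since a new vertex meets just `α` and `β`. The
-- choice of `β` comes after `α` is counted, so it may repeat a fresh `α` or be fresh in turn.
children : State → Arc → List State
children s@(state k K es) e =
  concatMap (λ α → concatMap (λ β → map (child s e α β) (upTo (suc k)))
                             (colourings es (hi e) (K ⊔ suc α)))
            (colourings es (lo e) K)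

survivors : State → Arc → List State
survivors s e = filterᵇ (λ s → not (nested s)) (children s e)

-- i ▸ ts plays the i-th arc and continues with ts on the surviving answers, in order.
infixr 6 _▸_
data Strategy : Set where
  _▸_ : ℕ → List Strategy → Strategy

-- Running out of rounds, an index past the last arc and a missing strategy all count as failure, so
-- `true` certifies a win.
refutes    : ℕ → State → Strategy → Bool
refutesAll : ℕ → List State → List Strategy → Bool

refutes zero    _ _        = false
refutes (suc d) s (i ▸ ts) with drop i (arcs s)
... | []    = false
... | e ∷ _ = refutesAll d (survivors s e) ts

refutesAll d []       _        = true
refutesAll d (_ ∷ _)  []       = false
refutesAll d (s ∷ ss) (t ∷ ts) = refutes d s t ∧ refutesAll d ss ts

-- Soundness of the game

-- Two points agree within each of p blocks, and then two blocks agree.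
pigeonhole₃ : ∀ {m p} → m < p → (f : Fin (p * p) → Fin m) → ∃ λ i → ∃ λ j → ∃ λ k →
              (i ≢ j × i ≢ k × j ≢ k) × f i ≡ f j × f i ≡ f k
pigeonhole₃ {m} {p} m<p f = across
  where
  within : ∀ b → ∃₂ λ i j → i Fin.< j × f (combine {p} {p} b i) ≡ f (combine b j)
  within b = pigeonhole m<p (λ i → f (combine b i))

  across : _
  across with pigeonhole m<p (λ b → f (combine b (proj₁ (within b))))
  ... | b , c , b<c , eq with within b
  ... | i , j , i<j , eq′ =
    combine b i , combine b j , combine c (proj₁ (within c)) ,
    ( (λ e → Fin.<⇒≢ i<j (proj₂ (combine-injective b i b j e)))
    , (λ e → Fin.<⇒≢ b<c (proj₁ (combine-injective b i c _ e)))
    , (λ e → Fin.<⇒≢ b<c (proj₁ (combine-injective b j c _ e)))) ,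
    eq′ , eq

-- Vertices and colours are numbered by total functions of which only an initial segment matters, so
-- an insertion does not change the index type.
insert : ℕ → A → (ℕ → A) → ℕ → A
insert zero    w φ zero    = w
insert zero    w φ (suc i) = φ i
insert (suc g) w φ zero    = φ zero
insert (suc g) w φ (suc i) = insert g w (φ ∘ suc) i

insert-at : ∀ g (w : A) φ → insert g w φ g ≡ w
insert-at zero    w φ = refl
insert-at (suc g) w φ = insert-at g w (φ ∘ suc)

insert-below : ∀ {g i} (w : A) φ → i < g → insert g w φ i ≡ φ i
insert-below {g = suc g} {zero}  w φ _   = refl
insert-below {g = suc g} {suc i} w φ i<g = insert-below w (φ ∘ suc) (s<s⁻¹ i<g)

insert-above : ∀ {g i} (w : A) φ → g ≤ i → insert g w φ (suc i) ≡ φ i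
insert-above {g = zero}          w φ _   = refl
insert-above {g = suc g} {suc i} w φ g≤i = insert-above w (φ ∘ suc) (s≤s⁻¹ g≤i)

insert-elim : ∀ (P : A → Set) g {k w φ} → g ≤ k → P w → (∀ {i} → i < k → P (φ i)) →
              ∀ {i} → i < suc k → P (insert g w φ i)
insert-elim P zero    g≤k Pw Pφ {zero}  _   = Pw
insert-elim P zero    g≤k Pw Pφ {suc i} i<k = Pφ (s<s⁻¹ i<k)
insert-elim P (suc g) {suc k} g≤k Pw Pφ {zero}  _   = Pφ z<s
insert-elim P (suc g) {suc k} g≤k Pw Pφ {suc i} i<k =
  insert-elim P g (s≤s⁻¹ g≤k) Pw (Pφ ∘ s<s) (s<s⁻¹ i<k)

-- Two-local layouts: queues, gaps and colours

module LowerBound {G : Graph n} (L : QueueLayout G) (local : QueueLayout.IsLocal L 2) where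
  open Graph G using (_~_)
  open QueueLayout L
  open IsStrictTotalOrder isStrictTotalOrder using (compare) renaming (trans to ≺-trans)

  Edge : Fin queues → Fin n → Fin n → Set
  Edge c u v = Σ (u ~ v) λ e → queue u v e ≡ c

  Edge-sym : ∀ {c u v} → Edge c u v → Edge c v u
  Edge-sym (e , eq) = Graph.sym G _ _ e , trans (sym (queue-sym _ _ e)) eq

  Edge⇒∈ : ∀ {c u v} → Edge c u v → c ∈ queuesAt u
  Edge⇒∈ {c} {u} {v} (e , eq) = ⋃⁺ c∈along (∈-map⁺ (queueAlong u) (∈-allFin v))
    where
    c∈along : c ∈ queueAlong u v
    c∈along with T? (Graph.adj G u v)
    ... | yes e′ = subst (λ d → c ∈ ⁅ d ⁆)
      (trans (sym eq) (cong (queue u v) (T-irrelevant e e′))) (x∈⁅x⁆ c)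
    ... | no ¬e  = contradiction e ¬e

  two-local : ∀ {a b c u x y z} → Edge a u x → Edge b u y → Edge c u z → a ≢ b → a ≢ c → b ≡ c
  two-local {b = b} {c} {u} ea eb ec a≢b a≢c with b Fin.≟ c
  ... | yes b≡c = b≡c
  ... | no  b≢c = contradiction
    (three-in-subset (Edge⇒∈ ea) (Edge⇒∈ eb) (Edge⇒∈ ec) a≢b a≢c b≢c) (≤⇒≯ (local u))

  Ascending : ℕ → (ℕ → Fin n) → Set
  Ascending k φ = ∀ {i j} → i < j → j < k → φ i ≺ φ j

  Gap : ℕ → (ℕ → Fin n) → ℕ → Fin n → Set
  Gap k φ g w = (∀ {i} → i < g → φ i ≺ w) × (∀ {i} → g ≤ i → i < k → w ≺ φ i)

  insert-ascending : ∀ {k g w φ} → g ≤ k → Ascending k φ → Gap k φ g w →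
                     Ascending (suc k) (insert g w φ)
  insert-ascending {g = zero}  g≤k asc (_ , after) {zero}  {suc j} _   j<k = after z≤n (s<s⁻¹ j<k)
  insert-ascending {g = zero}  g≤k asc gap         {suc i} {suc j} i<j j<k =
    asc (s<s⁻¹ i<j) (s<s⁻¹ j<k)
  insert-ascending {k = suc k} {suc g} {φ = φ} g≤k asc (before , _) {zero} {suc j} _ j<k =
    insert-elim (φ 0 ≺_) g (s≤s⁻¹ g≤k) (before z<s) (λ i<k → asc z<s (s<s i<k)) (s<s⁻¹ j<k)
  insert-ascending {k = suc k} {suc g} g≤k asc (before , after) {suc i} {suc j} i<j j<k =
    insert-ascending (s≤s⁻¹ g≤k) (λ i<j j<k → asc (s<s i<j) (s<s j<k))
      ((before ∘ s<s) , (λ g≤i i<k → after (s≤s g≤i) (s<s i<k))) (s<s⁻¹ i<j) (s<s⁻¹ j<k)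

  -- The k + 1 gaps of φ 0 ≺ … ≺ φ (k - 1), and these k vertices themselves.
  Position : ∀ k → (ℕ → Fin n) → Fin n → Fin (suc k) ⊎ Fin k → Set
  Position k φ w (inj₁ g) = Gap k φ (toℕ g) w
  Position k φ w (inj₂ i) = w ≡ φ (toℕ i)

  position : ∀ k φ → Ascending k φ → ∀ w → ∃ (Position k φ w)
  position zero    φ asc w = inj₁ zero , (λ ()) , λ _ ()
  position (suc k) φ asc w with compare w (φ 0)
  ... | tri< w≺ _ _ = inj₁ zero , (λ ()) ,
    λ { {zero} _ _ → w≺ ; {suc i} _ i<k → ≺-trans w≺ (asc z<s i<k) }
  ... | tri≈ _ w≡ _ = inj₂ zero , w≡
  ... | tri> _ _ ≺w with position k (φ ∘ suc) (λ i<j j<k → asc (s<s i<j) (s<s j<k)) w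
  ...   | inj₁ g , before , after =
    inj₁ (suc g) , (λ { {zero} _ → ≺w ; {suc i} i<g → before (s<s⁻¹ i<g) }) ,
    λ { {suc i} g≤i i<k → after (s≤s⁻¹ g≤i) (s<s⁻¹ i<k) }
  ...   | inj₂ i , w≡ = inj₂ (suc i) , w≡

  sort₃ : ∀ {P : Fin n → Set} {x y z} → x ≢ y → x ≢ z → y ≢ z → P x → P y → P z →
          ∃ λ a → ∃ λ b → ∃ λ c → a ≺ b × b ≺ c × P a × P b × P c
  sort₃ {x = x} {y} {z} x≢y x≢z y≢z px py pz with compare x y | compare x z | compare y z
  ... | tri≈ _ x≡y _ | _ | _ = contradiction x≡y x≢y
  ... | _ | tri≈ _ x≡z _ | _ = contradiction x≡z x≢z
  ... | _ | _ | tri≈ _ y≡z _ = contradiction y≡z y≢z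
  ... | tri< x≺y _ _ | _            | tri< y≺z _ _ = x , y , z , x≺y , y≺z , px , py , pz
  ... | tri< x≺y _ _ | tri< x≺z _ _ | tri> _ _ z≺y = x , z , y , x≺z , z≺y , px , pz , py
  ... | tri< x≺y _ _ | tri> _ _ z≺x | tri> _ _ z≺y = z , x , y , z≺x , x≺y , pz , px , py
  ... | tri> _ _ y≺x | tri< x≺z _ _ | _            = y , x , z , y≺x , x≺z , py , px , pz
  ... | tri> _ _ y≺x | tri> _ _ z≺x | tri< y≺z _ _ = y , z , x , y≺z , z≺x , py , pz , px
  ... | tri> _ _ y≺x | tri> _ _ z≺x | tri> _ _ z≺y = z , y , x , z≺y , y≺x , pz , py , px

  -- Besides `c` there is room for only one more queue at `u`, so comparing a queue with `c`
  -- determines it.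
  alike : ∀ {a b c u x y z} → Edge c u x → Edge a u y → Edge b u z →
          does (a Fin.≟ c) ≡ does (b Fin.≟ c) → a ≡ b
  alike {a} {b} {c} ec ea eb eq with a Fin.≟ c | b Fin.≟ c
  ... | yes a≡c | yes b≡c = trans a≡c (sym b≡c)
  ... | no  a≢c | no  b≢c = two-local ec ea eb (a≢c ∘ sym) (b≢c ∘ sym)

  InjectiveBelow : ℕ → (ℕ → Fin queues) → Set
  InjectiveBelow K γ = ∀ {a b} → a < K → b < K → γ a ≡ γ b → a ≡ b

  -- A queue that has a number keeps it, and a new one receives `K`. In the first case `K ⊔ suc α`
  -- is `K`, in the second `suc K`, just as in `child`.
  introduce : ∀ K γ l → InjectiveBelow K γ → ∃₂ λ α γ′ → α ≤ K × γ′ α ≡ l ×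
              (∀ {a} → a < K → γ′ a ≡ γ a) × InjectiveBelow (K ⊔ suc α) γ′
  introduce K γ l inj with anyUpTo? (λ a → γ a Fin.≟ l) K
  ... | yes (α , α<K , eq) = α , γ , <⇒≤ α<K , eq , (λ _ → refl) ,
    subst (λ K → InjectiveBelow K γ) (sym (m≥n⇒m⊔n≡m α<K)) inj
  ... | no new = K , insert K l γ , ≤-refl , insert-at K l γ , insert-below l γ ,
    subst (λ K′ → InjectiveBelow K′ (insert K l γ)) (sym (m≤n⇒m⊔n≡n (n≤1+n K))) inj′
    where
    fresh : ∀ {a} → a < K → insert K l γ a ≢ insert K l γ K
    fresh a<K eq = new (_ , a<K , trans (sym (insert-below l γ a<K)) (trans eq (insert-at K l γ)))

    inj′ : InjectiveBelow (suc K) (insert K l γ)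
    inj′ a<K b<K eq with m≤n⇒m<n∨m≡n (s≤s⁻¹ a<K) | m≤n⇒m<n∨m≡n (s≤s⁻¹ b<K)
    ... | inj₁ a<K | inj₁ b<K =
      inj a<K b<K (trans (sym (insert-below l γ a<K)) (trans eq (insert-below l γ b<K)))
    ... | inj₁ a<K | inj₂ refl = contradiction eq (fresh a<K)
    ... | inj₂ refl | inj₁ b<K = contradiction (sym eq) (fresh b<K)
    ... | inj₂ refl | inj₂ refl = refl

  Labelled : (ℕ → Fin n) → (ℕ → Fin queues) → ℕ → Arc → Set
  Labelled φ γ K (arc u v c) = c < K × Edge (γ c) (φ u) (φ v)

  -- Two colours at `x` that both differ from `α` name the same queue by `two-local`, and then they
  -- are equal because `γ` is injective below `K`.
  crowded-sound : ∀ {φ γ K α x y es} → InjectiveBelow K γ → α < K → Edge (γ α) (φ x) y →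
                  All (Labelled φ γ K) es → ¬ T (crowded es x α)
  crowded-sound {φ} {γ} {K} {α} {x} {es = es} inj α<K e all t =
    let a , a∈ , ta = find (any⁻ _ _ t)
        b , b∈ , tb = find (any⁻ _ _ ta)
        a≢b , t′    = Equivalence.to T-∧ tb
        a≢α , b≢α   = Equivalence.to T-∧ t′
        _ , a<K , ea = at-x a∈
        _ , b<K , eb = at-x b∈
    in differ a≢b (inj a<K b<K (two-local e ea eb
         (differ a≢α ∘ inj a<K α<K ∘ sym) (differ b≢α ∘ inj b<K α<K ∘ sym)))
    where
    differ : ∀ {a b} → T (not (a ≡ᵇ b)) → a ≢ b
    differ {a} {b} t eq with a ≡ᵇ b | ≡⇒≡ᵇ a b eq
    ... | true | _ = t

    at-x : ∀ {a} → a ∈ₗ map colour (filterᵇ (λ e → (lo e ≡ᵇ x) ∨ (hi e ≡ᵇ x)) es) →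
           ∃ λ y → a < K × Edge (γ a) (φ x) y
    at-x a∈ with ∈-map⁻ colour a∈
    ... | f , f∈ , refl with ∈-filter⁻ (λ e → T? ((lo e ≡ᵇ x) ∨ (hi e ≡ᵇ x))) {xs = es} f∈
    ... | f∈es , tf with All.lookup all f∈es | Equivalence.to (T-∨ {lo f ≡ᵇ x}) tf
    ... | c<K , ef | inj₁ t rewrite ≡ᵇ⇒≡ (lo f) x t = _ , c<K , ef
    ... | c<K , ef | inj₂ t rewrite ≡ᵇ⇒≡ (hi f) x t = _ , c<K , Edge-sym ef

  -- Layouts realizing a state of the game

  module _ (p : ℕ) where

    -- As many children as `pigeonhole₃` needs to find three of one kind among fewer than `p` kinds.
    N : ℕ
    N = p * p

    Drawn : ℕ → (ℕ → Fin n) → (ℕ → Fin queues) → ℕ → ℕ → Arc → Set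
    Drawn d φ γ k K (arc u v c) =
      u < k × v < k × c < K × Edge (γ c) (φ u) (φ v) × Rich G N d (φ u) (φ v)

    record Realizes (d : ℕ) (s : State) : Set where
      field
        vertex    : ℕ → Fin n
        label     : ℕ → Fin queues
        ascending : Ascending (size s) vertex
        injective : InjectiveBelow (colours s) label
        drawn     : All (Drawn d vertex label (size s) (colours s)) (arcs s)

    nested-sound : ∀ {d s} → Realizes d s → ¬ T (nested s)
    nested-sound {d} {s} R t =
      let e , e∈ , te = find (any⁻ _ _ t)
          f , f∈ , tf = find (any⁻ _ _ te)
      in go (All.lookup (All.take⁺ 6 drawn) e∈) (All.lookup drawn f∈) tf
      where
      open Realizes R
      go : ∀ {e f} → Drawn d vertex label _ _ e → Drawn d vertex label _ _ f → ¬ T (clashes e f)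
      go {arc u v c} {arc x y c′} (_ , v<k , _ , (e , eq) , _) (_ , y<k , _ , (f , eq′) , _) t
        with Equivalence.to (T-∧ {c ≡ᵇ c′}) t
      ... | c≡c′ , t rewrite ≡ᵇ⇒≡ c c′ c≡c′ with Equivalence.to T-∨ t
      ... | inj₁ t =
        let a , t  = Equivalence.to (T-∧ {u <ᵇ x}) t
            b , c  = Equivalence.to (T-∧ {y <ᵇ v}) t
        in nonNesting _ _ _ _ e f
             (inj₁ (ascending (<ᵇ⇒< _ _ a) (<-trans (<ᵇ⇒< _ _ c) y<k) , ascending (<ᵇ⇒< _ _ c) y<k ,
                    ascending (<ᵇ⇒< _ _ b) v<k))
             (trans eq (sym eq′))
      ... | inj₂ t =
        let a , t  = Equivalence.to (T-∧ {x <ᵇ u}) t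
            b , c  = Equivalence.to (T-∧ {v <ᵇ y}) t
        in nonNesting _ _ _ _ e f
             (inj₂ (ascending (<ᵇ⇒< _ _ a) (<-trans (<ᵇ⇒< _ _ c) v<k) , ascending (<ᵇ⇒< _ _ c) v<k ,
                    ascending (<ᵇ⇒< _ _ b) y<k))
             (trans eq (sym eq′))

    record Alike (d k : ℕ) (φ : ℕ → Fin n) (u v : Fin n) : Set where
      field
        gap   : ℕ
        gap≤k : gap ≤ k
        l l′  : Fin queues

      Member : Fin n → Set
      Member w = Gap k φ gap w × (Edge l u w × Rich G N d u w) × (Edge l′ v w × Rich G N d v w)

      field
        a b c    : Fin n
        a≺b      : a ≺ b
        b≺c      : b ≺ c
        member-a : Member a
        member-b : Member b
        member-c : Member c

    bit : Bool → Fin 2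
    bit true  = zero
    bit false = suc zero

    bit-injective : ∀ {a b} → bit a ≡ bit b → a ≡ b
    bit-injective {true}  {true}  _ = refl
    bit-injective {false} {false} _ = refl

    -- A child is coded by its position, one of `suc k` gaps or `k` old vertices, and by two bits
    -- telling whether its edges to `u` and `v` share the queue of `uv`. By `alike`, equal codes
    -- give equal queues.
    alike-children : ∀ {d k φ u v} → (suc k + k) * 4 < p → Ascending k φ → Rich G N (suc d) u v →
                     Alike d k φ u v
    alike-children {d} {k} {φ} {u} {v} small asc (node e w inj rich) = result
      where
      pos : ∀ i → ∃ (Position k φ (w i))
      pos i = position k φ asc (w i)
      l₁ l₂ : Fin N → Fin queues
      l₁ i = queue u (w i) (Rich⇒~ (proj₁ (rich i)))
      l₂ i = queue v (w i) (Rich⇒~ (proj₂ (rich i)))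
      b₁ b₂ : Fin N → Bool
      b₁ i = does (l₁ i Fin.≟ queue u v e)
      b₂ i = does (l₂ i Fin.≟ queue u v e)
      edge₁ : ∀ i → Edge (l₁ i) u (w i)
      edge₁ i = Rich⇒~ (proj₁ (rich i)) , refl
      edge₂ : ∀ i → Edge (l₂ i) v (w i)
      edge₂ i = Rich⇒~ (proj₂ (rich i)) , refl

      code : Fin N → Fin ((suc k + k) * 4)
      code i = combine (join (suc k) k (proj₁ (pos i))) (combine (bit (b₁ i)) (bit (b₂ i)))

      decode : ∀ {i j} → code i ≡ code j → proj₁ (pos i) ≡ proj₁ (pos j) × l₁ i ≡ l₁ j × l₂ i ≡ l₂ j
      decode {i} {j} eq =
        let eq₁ , eq₂ = combine-injective (join (suc k) k (proj₁ (pos i))) _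
                                          (join (suc k) k (proj₁ (pos j))) _ eq
            eq₃ , eq₄ = combine-injective (bit (b₁ i)) (bit (b₂ i)) (bit (b₁ j)) (bit (b₂ j)) eq₂
        in trans (sym (splitAt-join (suc k) k (proj₁ (pos i))))
             (trans (cong (splitAt (suc k)) eq₁) (splitAt-join (suc k) k (proj₁ (pos j)))) ,
           alike (e , refl) (edge₁ i) (edge₁ j) (bit-injective eq₃) ,
           alike (Edge-sym (e , refl)) (edge₂ i) (edge₂ j) (bit-injective eq₄)

      result : Alike d k φ u v
      result with pigeonhole₃ small code
      ... | i , j , m , (i≢j , i≢m , j≢m) , eqj , eqm with decode eqj | decode eqm
      ... | posj , l₁j , l₂j | posm , l₁m , l₂m
        with pos i | subst (Position k φ (w j)) (sym posj) (proj₂ (pos j))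
                   | subst (Position k φ (w m)) (sym posm) (proj₂ (pos m))
      -- Distinct children cannot be the same old vertex, so the common position is a gap.
      ... | inj₂ x , eqi | eqj | _ = contradiction (inj (trans eqi (sym eqj))) i≢j
      ... | inj₁ g , gapi | gapj | gapm =
        let a , b , c , a≺b , b≺c , pa , pb , pc = sort₃ {P = P} (i≢j ∘ inj) (i≢m ∘ inj) (j≢m ∘ inj)
              (gapi , (edge₁ i , proj₁ (rich i)) , (edge₂ i , proj₂ (rich i)))
              (gapj , (subst (λ l → Edge l u (w j)) (sym l₁j) (edge₁ j) , proj₁ (rich j)) ,
                      (subst (λ l → Edge l v (w j)) (sym l₂j) (edge₂ j) , proj₂ (rich j)))
              (gapm , (subst (λ l → Edge l u (w m)) (sym l₁m) (edge₁ m) , proj₁ (rich m)) ,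
                      (subst (λ l → Edge l v (w m)) (sym l₂m) (edge₂ m) , proj₂ (rich m)))
        in record { gap = toℕ g ; gap≤k = s≤s⁻¹ (toℕ<n g) ; a = a ; b = b ; c = c
                  ; a≺b = a≺b ; b≺c = b≺c ; member-a = pa ; member-b = pb ; member-c = pc }
        where
        P : Fin n → Set
        P y = Gap k φ (toℕ g) y ×
              (Edge (l₁ i) u y × Rich G N d u y) × (Edge (l₂ i) v y × Rich G N d v y)

    -- Lets the three children enter at one index, the last of them first: after `y` is inserted at
    -- `g`, a smaller `x` still fits there, just before `y`.
    Gap-tail : ∀ {k φ g x y} → x ≺ y → Gap k φ g x → Gap k φ g y → Gap (suc k) (insert g y φ) g x
    Gap-tail {φ = φ} {g} {x} {y} x≺y (before , after) (before′ , after′) = before″ , after″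
      where
      before″ : ∀ {i} → i < g → insert g y φ i ≺ x
      before″ i<g = subst (_≺ x) (sym (insert-below y φ i<g)) (before i<g)
      after″ : ∀ {i} → g ≤ i → i < suc _ → x ≺ insert g y φ i
      after″ {i} g≤i i<k with m≤n⇒m<n∨m≡n g≤i
      ... | inj₂ refl = subst (x ≺_) (sym (insert-at g y φ)) x≺y
      after″ {suc i} g≤i i<k | inj₁ g<i =
        subst (x ≺_) (sym (insert-above y φ (s≤s⁻¹ g<i))) (after (s≤s⁻¹ g<i) (s<s⁻¹ i<k))

    module Triple {d k φ u v} (A : Alike d k φ u v) (asc : Ascending k φ) where
      open Alike A

      φ₁ φ₂ φ₃ : ℕ → Fin n
      φ₁ = insert gap c φ
      φ₂ = insert gap b φ₁
      φ₃ = insert gap a φ₂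

      φ₃-ascending : Ascending (3 + k) φ₃
      φ₃-ascending =
        insert-ascending (m≤n⇒m≤1+n (m≤n⇒m≤1+n gap≤k))
          (insert-ascending (m≤n⇒m≤1+n gap≤k)
            (insert-ascending gap≤k asc (proj₁ member-c)) gap-b)
          (Gap-tail a≺b (Gap-tail (≺-trans a≺b b≺c) (proj₁ member-a) (proj₁ member-c)) gap-b)
        where
        gap-b : Gap (suc k) φ₁ gap b
        gap-b = Gap-tail b≺c (proj₁ member-b) (proj₁ member-c)

      new : ∀ {j} → j < 3 → Member (φ₃ (j + gap))
      new {0} _ = subst Member (sym (insert-at gap a φ₂)) member-a
      new {1} _ =
        subst Member (sym (trans (insert-above a φ₂ ≤-refl) (insert-at gap b φ₁))) member-b
      new {2} _ = subst Member (sym (trans (insert-above a φ₂ (n≤1+n gap))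
                    (trans (insert-above b φ₁ ≤-refl) (insert-at gap c φ)))) member-c
      new {suc (suc (suc j))} j<3 = contradiction j<3 (≤⇒≯ (m≤m+n 3 j))

      old : ∀ i → φ₃ (shift gap i) ≡ φ i
      old i with i <ᵇ gap in eq
      ... | true  = trans (insert-below a φ₂ i<g)
                      (trans (insert-below b φ₁ i<g) (insert-below c φ i<g))
        where i<g = <ᵇ⇒< i gap (subst T (sym eq) tt)
      ... | false = trans (insert-above a φ₂ (m≤n⇒m≤1+n (m≤n⇒m≤1+n g≤i)))
                      (trans (insert-above b φ₁ (m≤n⇒m≤1+n g≤i)) (insert-above c φ g≤i))
        where g≤i = ≮⇒≥ λ i<g → subst T eq (<⇒<ᵇ {i} {gap} i<g)

      shift< : ∀ {i} → i < k → shift gap i < 3 + k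
      shift< {i} i<k with i <ᵇ gap
      ... | true  = m≤n⇒m≤o+n 3 i<k
      ... | false = +-monoʳ-< 3 i<k

      Drawn-spoke : ∀ {γ K i j α} → i < k → α < K → j < 3 →
                    Edge (γ α) (φ i) (φ₃ (j + gap)) × Rich G N d (φ i) (φ₃ (j + gap)) →
                    Drawn d φ₃ γ (3 + k) K (spoke gap i α j)
      -- The facts about `shift gap i` are abstracted along with the test, so that they reduce in
      -- step with `spoke`.
      Drawn-spoke {i = i} {j} i<k α<K j<3 (e , r) with i <ᵇ gap | old i | shift< i<k
      ... | true  | eq | i< = i< , +-mono-<-≤ j<3 gap≤k , α<K ,
        subst (λ x → Edge _ x (φ₃ (j + gap))) (sym eq) e ,
        subst (λ x → Rich G N d x (φ₃ (j + gap))) (sym eq) r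
      ... | false | eq | i< = +-mono-<-≤ j<3 gap≤k , i< , α<K ,
        Edge-sym (subst (λ x → Edge _ x (φ₃ (j + gap))) (sym eq) e) ,
        Rich-sym (subst (λ x → Rich G N d x (φ₃ (j + gap))) (sym eq) r)

      Drawn-shift : ∀ {γ γ′ K K′ e} → K ≤ K′ → (∀ {a} → a < K → γ′ a ≡ γ a) →
                    Drawn (suc d) φ γ k K e →
                    Drawn d φ₃ γ′ (3 + k) K′
                      (arc (shift gap (lo e)) (shift gap (hi e)) (colour e))
      Drawn-shift {e = arc x y c} K≤K′ ext (x<k , y<k , c<K , e , r)
        rewrite sym (old x) | sym (old y) | sym (ext c<K) =
        shift< x<k , shift< y<k , <-≤-trans c<K K≤K′ , e , Rich-pred d r

    -- The answer of a layout to a move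

    not⁺ : ∀ {b} → ¬ T b → T (not b)
    not⁺ {true}  f = f tt
    not⁺ {false} _ = tt

    -- The parameters from `α` on are what two successive uses of `introduce` yield, first for the
    -- queue of the children at `u`, then for that at `v`.
    module Response {d k K : ℕ} {es : List Arc} {u v κ : ℕ}
      (R : Realizes (suc d) (state k K es)) (u<k : u < k) (v<k : v < k)
      (A : Alike d k (Realizes.vertex R) (Realizes.vertex R u) (Realizes.vertex R v))
      {α : ℕ} {γ : ℕ → Fin queues} (α≤K : α ≤ K) (γα≡l : γ α ≡ Alike.l A)
      (ext : ∀ {a} → a < K → γ a ≡ Realizes.label R a)
      {β : ℕ} {γ′ : ℕ → Fin queues} (β≤K′ : β ≤ K ⊔ suc α)
      (γ′β≡l′ : γ′ β ≡ Alike.l′ A) (ext′ : ∀ {a} → a < K ⊔ suc α → γ′ a ≡ γ a)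
      (inj′ : InjectiveBelow ((K ⊔ suc α) ⊔ suc β) γ′) where

      open Realizes R
      open Alike A
      open Triple A ascending
      K′ = K ⊔ suc α
      K″ = K′ ⊔ suc β

      s s′ : State
      s = state k K es
      s′ = child s (arc u v κ) α β gap

      α<K′ : α < K′
      α<K′ = m≤n⊔m K (suc α)

      α<K″ : α < K″
      α<K″ = <-≤-trans α<K′ (m≤m⊔n K′ (suc β))

      β<K″ : β < K″
      β<K″ = m≤n⊔m K′ (suc β)

      γ′α≡l : γ′ α ≡ l
      γ′α≡l = trans (ext′ α<K′) γα≡l

      ext″ : ∀ {a} → a < K → γ′ a ≡ label a
      ext″ a<K = trans (ext′ (<-≤-trans a<K (m≤m⊔n K (suc α)))) (ext a<K)

      K≤K″ : K ≤ K″
      K≤K″ = ≤-trans (m≤m⊔n K (suc α)) (m≤m⊔n K′ (suc β))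

      realizes : Realizes d s′
      realizes = record
        { vertex    = φ₃
        ; label     = γ′
        ; ascending = φ₃-ascending
        ; injective = inj′
        ; drawn     = All.++⁺ (All.map⁺ (All.tabulate (λ j∈ → spoke₁ (∈-upTo⁻ j∈))))
                        (All.++⁺ (All.map⁺ (All.tabulate (λ j∈ → spoke₂ (∈-upTo⁻ j∈))))
                          (All.map⁺ (All.map (Drawn-shift K≤K″ ext″) drawn)))
        }
        where
        spoke₁ : ∀ {j} → j < 3 → Drawn d φ₃ γ′ (3 + k) K″ (spoke gap u α j)
        spoke₁ j<3 = let _ , (e , r) , _ = new j<3 in
          Drawn-spoke {γ = γ′} u<k α<K″ j<3 (subst (λ l → Edge l _ _) (sym γ′α≡l) e , r)
        spoke₂ : ∀ {j} → j < 3 → Drawn d φ₃ γ′ (3 + k) K″ (spoke gap v β j)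
        spoke₂ j<3 = let _ , _ , (e , r) = new j<3 in
          Drawn-spoke {γ = γ′} v<k β<K″ j<3 (subst (λ l → Edge l _ _) (sym γ′β≡l′) e , r)

      -- Crowding is tested on the old arcs: positions are still the old ones, while colours are
      -- already read through `γ′`.
      labelled : All (Labelled vertex γ′ K″) es
      labelled = All.map (λ { (_ , _ , c<K , e , _) →
        <-≤-trans c<K K≤K″ , subst (λ l → Edge l _ _) (sym (ext″ c<K)) e }) drawn

      allowed : ∀ {x y κ K} → κ < suc K → κ < K″ → Edge (γ′ κ) (vertex x) y →
                κ ∈ₗ colourings es x K
      allowed {x} κ<K κ<K″ e = ∈-filter⁺ (λ α → T? (not (crowded es x α))) (∈-upTo⁺ κ<K)
        (not⁺ (crowded-sound inj′ κ<K″ e labelled))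

      s′∈children : s′ ∈ₗ children s (arc u v κ)
      s′∈children = ∈-concatMap⁺ _ (Any.map (λ { refl →
        ∈-concatMap⁺ _ (Any.map (λ { refl → ∈-map⁺ _ (∈-upTo⁺ (s≤s gap≤k)) }) β∈) }) α∈)
        where
        α∈ : α ∈ₗ colourings es u K
        α∈ = allowed (s≤s α≤K) α<K″
          (subst (λ l → Edge l _ _) (sym γ′α≡l) (proj₁ (proj₁ (proj₂ member-a))))
        β∈ : β ∈ₗ colourings es v K′
        β∈ = allowed (s≤s β≤K′) β<K″
          (subst (λ l → Edge l _ _) (sym γ′β≡l′) (proj₁ (proj₂ (proj₂ member-a))))

      survives : s′ ∈ₗ survivors s (arc u v κ)
      survives = ∈-filter⁺ (λ s → T? (not (nested s))) s′∈children (not⁺ (nested-sound realizes))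

    -- Winning strategies exclude realizations

    Roomy : ℕ → Set
    Roomy k = (suc k + k) * 4 < p

    respond : ∀ {d s e} → Roomy (size s) → Realizes (suc d) s → e ∈ₗ arcs s →
              ∃ λ s′ → size s′ ≡ 3 + size s × s′ ∈ₗ survivors s e × Realizes d s′
    respond {s = s} {e} roomy R e∈ =
      let open Realizes R
          u<k , v<k , _ , _ , rich = All.lookup drawn e∈
          A = alike-children roomy ascending rich
          α , γ , α≤K , γα≡l , ext , inj = introduce (colours s) label (Alike.l A) injective
          β , γ′ , β≤K′ , γ′β≡l′ , ext′ , inj′ =
            introduce (colours s ⊔ suc α) γ (Alike.l′ A) inj
          open Response {κ = colour e} R u<k v<k A
                 {γ = γ} α≤K γα≡l ext {γ′ = γ′} β≤K′ γ′β≡l′ ext′ inj′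
      in s′ , refl , survives , realizes

    -- By `respond`, the layout always has an answer among the survivors, so a branch without
    -- survivors is contradictory. A round adds three vertices, so room for `d * 3` more lasts to
    -- the end.
    refutes-sound    : ∀ d {s} t → Roomy (d * 3 + size s) →
                       refutes d s t ≡ true → ¬ Realizes d s
    refutesAll-sound : ∀ d {s ss} ts → Roomy (d * 3 + size s) →
                       refutesAll d ss ts ≡ true → s ∈ₗ ss → ¬ Realizes d s

    refutes-sound (suc d) {s} (i ▸ ts) roomy won R with drop i (arcs s) in eq
    ... | e ∷ _ =
      let s′ , size-s′ , s′∈ , R′ =
            respond (≤-<-trans (*-monoˡ-≤ 4 (+-mono-≤ (s≤s size≤) size≤)) roomy) R e∈
      in refutesAll-sound d ts (roomy′ {s′} size-s′) won s′∈ R′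
      where
      size≤ : size s ≤ suc d * 3 + size s
      size≤ = m≤n+m _ (suc d * 3)

      e∈ : e ∈ₗ arcs s
      e∈ = drop-⊆ i (subst (e ∈ₗ_) (sym eq) (here refl))
        where
        drop-⊆ : ∀ i {es : List Arc} → e ∈ₗ drop i es → e ∈ₗ es
        drop-⊆ zero    e∈ = e∈
        drop-⊆ (suc i) {_ ∷ _} e∈ = there (drop-⊆ i e∈)

      roomy′ : ∀ {s′} → size s′ ≡ 3 + size s → Roomy (d * 3 + size s′)
      roomy′ {s′} size-s′ = subst Roomy eq′ roomy
        where
        eq′ : suc d * 3 + size s ≡ d * 3 + size s′
        eq′ = trans (cong (_+ size s) (+-comm 3 (d * 3)))
                (trans (+-assoc (d * 3) 3 _) (cong (d * 3 +_) (sym size-s′)))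

    refutesAll-sound d {ss = s ∷ ss} (t ∷ ts) roomy won (here refl) =
      refutes-sound d t roomy (∧-conicalˡ _ (refutesAll d ss ts) won)
    refutesAll-sound d {ss = s ∷ ss} (t ∷ ts) roomy won (there s∈) =
      refutesAll-sound d ts roomy (∧-conicalʳ (refutes d s t) _ won) s∈

-- Found by computer search.
strategy : Strategy
strategy =
  0 ▸
    ( 1 ▸
        ( 4 ▸ [ 4 ▸ [ 8 ▸ [] ] ]
        ∷ 4 ▸ []
        ∷ 4 ▸ []
        ∷ 3 ▸ []
        ∷ 3 ▸ [ 1 ▸ [ 9 ▸ [] ] ]
        ∷ 4 ▸
            ( 1 ▸ [ 10 ▸ [] ]
            ∷ 1 ▸ []
            ∷ 0 ▸ []
            ∷ 0 ▸ [ 1 ▸ [ 9 ▸ [] ] ]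
            ∷ 0 ▸ [ 1 ▸ [ 9 ▸ [] ] ]
            ∷ 1 ▸ (10 ▸ [] ∷ 10 ▸ [] ∷ 10 ▸ [] ∷ [])
            ∷ 1 ▸ (10 ▸ [] ∷ 10 ▸ [] ∷ [])
            ∷ 1 ▸ [ 10 ▸ [] ]
            ∷ [] )
        ∷ 4 ▸
            ( 1 ▸ [ 10 ▸ [] ]
            ∷ 1 ▸ [ 10 ▸ [] ]
            ∷ 1 ▸ []
            ∷ 0 ▸ []
            ∷ 0 ▸ (1 ▸ [ 9 ▸ [] ] ∷ 1 ▸ [ 9 ▸ [] ] ∷ [])
            ∷ 1 ▸ (10 ▸ [] ∷ 10 ▸ [] ∷ 10 ▸ [] ∷ [])
            ∷ 1 ▸ (10 ▸ [] ∷ 10 ▸ [] ∷ [])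
            ∷ 1 ▸ [ 10 ▸ [] ]
            ∷ [] )
        ∷ 4 ▸ [ 4 ▸ [ 8 ▸ [] ] ]
        ∷ 4 ▸
            ( 1 ▸ []
            ∷ 1 ▸ []
            ∷ 1 ▸ (10 ▸ [] ∷ 10 ▸ [] ∷ 10 ▸ [] ∷ [])
            ∷ 1 ▸ (10 ▸ [] ∷ 10 ▸ [] ∷ [])
            ∷ 1 ▸ [ 10 ▸ [] ]
            ∷ [] )
        ∷ 4 ▸
            ( 1 ▸ []
            ∷ 1 ▸ (10 ▸ [] ∷ 10 ▸ [] ∷ 10 ▸ [] ∷ [])
            ∷ 1 ▸ (10 ▸ [] ∷ 10 ▸ [] ∷ [])
            ∷ 1 ▸ [ 10 ▸ [] ]
            ∷ [] )
        ∷ 4 ▸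
            ( 1 ▸ (9 ▸ [] ∷ 9 ▸ [] ∷ 9 ▸ [] ∷ [])
            ∷ 1 ▸ (9 ▸ [] ∷ 9 ▸ [] ∷ [])
            ∷ 1 ▸ [ 9 ▸ [] ]
            ∷ [] )
        ∷ 4 ▸ (1 ▸ (9 ▸ [] ∷ 9 ▸ [] ∷ []) ∷ 1 ▸ [ 9 ▸ [] ] ∷ [])
        ∷ 1 ▸ [ 10 ▸ [] ]
        ∷ [] )
    ∷ 4 ▸ [ 4 ▸ [ 8 ▸ [] ] ]
    ∷ 4 ▸ (1 ▸ [ 1 ▸ [ 9 ▸ [] ] ] ∷ 1 ▸ [ 9 ▸ [] ] ∷ [])
    ∷ 4 ▸ (1 ▸ [ 9 ▸ [] ] ∷ 1 ▸ [ 9 ▸ [] ] ∷ [])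
    ∷ 1 ▸ (4 ▸ [ 8 ▸ [] ] ∷ 4 ▸ [ 8 ▸ [] ] ∷ [])
    ∷ 1 ▸ (1 ▸ [ 9 ▸ [] ] ∷ 4 ▸ [ 4 ▸ [ 8 ▸ [] ] ] ∷ [])
    ∷ 1 ▸ [ 1 ▸ [ 9 ▸ [] ] ]
    ∷ 1 ▸
        ( 4 ▸ [ 4 ▸ [ 8 ▸ [] ] ]
        ∷ 4 ▸ [ 1 ▸ [ 10 ▸ [] ] ]
        ∷ 4 ▸ [ 1 ▸ [ 10 ▸ [] ] ]
        ∷ 4 ▸ [ 7 ▸ [] ]
        ∷ 4 ▸ [ 7 ▸ [] ]
        ∷ 1 ▸ [ 9 ▸ [] ]
        ∷ 4 ▸ [ 4 ▸ [ 8 ▸ [] ] ]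
        ∷ 4 ▸ [ 4 ▸ [ 8 ▸ [] ] ]
        ∷ 4 ▸ [ 1 ▸ [ 10 ▸ [] ] ]
        ∷ 4 ▸ []
        ∷ 3 ▸ []
        ∷ 3 ▸ [ 1 ▸ [ 9 ▸ [] ] ]
        ∷ [] )
    ∷ 1 ▸
        ( 4 ▸ [ 4 ▸ [ 8 ▸ [] ] ]
        ∷ 10 ▸ (10 ▸ [ 4 ▸ [ 8 ▸ [] ] ] ∷ 10 ▸ [ 4 ▸ [ 8 ▸ [] ] ] ∷ 4 ▸ [] ∷ [])
        ∷ 1 ▸ (4 ▸ [ 8 ▸ [] ] ∷ 4 ▸ [ 8 ▸ [] ] ∷ [])
        ∷ [] )
    ∷ 1 ▸
        ( 4 ▸ [ 7 ▸ [] ]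
        ∷ 1 ▸ [ 10 ▸ [] ]
        ∷ 4 ▸ [ 4 ▸ [ 8 ▸ [] ] ]
        ∷ 4 ▸ [ 1 ▸ [ 10 ▸ [] ] ]
        ∷ 4 ▸ [ 4 ▸ [ 8 ▸ [] ] ]
        ∷ 4 ▸ []
        ∷ [] )
    ∷ 4 ▸
        ( 7 ▸ (1 ▸ [] ∷ 7 ▸ [ 1 ▸ [ 9 ▸ [] ] ] ∷ 7 ▸ [ 1 ▸ [ 9 ▸ [] ] ] ∷ [])
        ∷ 1 ▸ [ 1 ▸ [ 9 ▸ [] ] ]
        ∷ 4 ▸ (1 ▸ [ 9 ▸ [] ] ∷ 1 ▸ [ 9 ▸ [] ] ∷ [])
        ∷ [] )
    ∷ [] )

root : State
root = state 2 1 [ arc 0 1 0 ]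

strategy-wins : refutes 6 root strategy ≡ true
strategy-wins = refl

-- A state of the game has at most 2 + 3 · 6 = 20 vertices, hence 41 positions for a new vertex,
-- each with 4 colour patterns of its two edges, and 41 · 4 < 165.
capacity : ℕ
capacity = 165

-- Treewidth and local queue number of a rich two-tree

module _ {G : Graph n} (L : QueueLayout G) (local : QueueLayout.IsLocal L 2) where
  open QueueLayout L
  open IsStrictTotalOrder isStrictTotalOrder using (compare)
  open LowerBound L local

  oriented-rich-impossible : ∀ {u v} → u ≺ v → ¬ Rich G (capacity * capacity) 6 u v
  oriented-rich-impossible {u} {v} u≺v r =
    refutes-sound capacity 6 {root} strategy (n<1+n 164) strategy-wins record
      { vertex    = endpoint
      -- The root uses only colour 0 and the vertices 0 and 1; all other values are arbitrary.
      ; label     = λ _ → queue u v (Rich⇒~ r)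
      ; ascending = λ { {zero} {suc zero} _ _ → u≺v ; {suc i} {suc zero} (s<s ()) _
                      ; {_} {suc (suc _)} _ (s<s (s<s ())) }
      ; injective = λ { {zero} {zero} _ _ _ → refl ; {suc _} (s<s ()) ; {_} {suc _} _ (s<s ()) }
      ; drawn     = (z<s , s<s z<s , z<s , (Rich⇒~ r , refl) , r) All.∷ All.[]
      }
    where
    endpoint : ℕ → Fin n
    endpoint zero    = u
    endpoint (suc _) = v

  rich-impossible : ∀ {u v} → ¬ Rich G (capacity * capacity) 6 u v
  rich-impossible {u} {v} r with compare u v
  ... | tri< u≺v _ _    = oriented-rich-impossible u≺v r
  ... | tri≈ _ refl _   = Graph.irrefl G u (Rich⇒~ r)
  ... | tri> _ _ v≺u    = oriented-rich-impossible v≺u (Rich-sym r)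

-- The index `i` selects a child that forms a triangle with `u` and `v`, which bounds every width
-- from below; the bags of `decompose` attain the bound.
treewidth-2 : ∀ {N d} {G : Graph n} {u v} → Fin N → TwoTree G → Rich G N (suc d) u v →
              Treewidth G 2
treewidth-2 {G = G} i T (node uv w _ rich) with decompose T
... | D , small =
  (D , ≤-antisym (pred-mono-≤ (foldr-⊔-lub _ small)) (2≤ D)) , λ { _ (D , refl) → 2≤ D }
  where
  2≤ : (D : TreeDecomposition G) → 2 ≤ TreeDecomposition.width D
  2≤ D = 2≤width D uv (Rich⇒~ (proj₁ (rich i))) (Rich⇒~ (proj₂ (rich i)))

localQueueNumber-3 : ∀ {G : Graph n} {u v} → TwoTree G → Rich G (capacity * capacity) 6 u v →
                     LocalQueueNumber G 3
localQueueNumber-3 {G = G} T r = (starLayout G , starLayout-local T) , λ j (L , local) →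
  -- Locality below 3 implies two-locality.
  ≮⇒≥ λ j<3 → rich-impossible L (λ v → ≤-trans (local v) (s≤s⁻¹ j<3)) r

rich-extension : ∀ {G : Graph n} {u v} →
                 Extension G (λ {_} {H} f → Rich H (capacity * capacity) 6 (to f u) (to f v)) →
                 ∃ λ n → ∃ λ (G : Graph n) → Treewidth G 2 × LocalQueueNumber G 3
rich-extension (extension T f r) =
  _ , _ , treewidth-2 (combine 0F 0F) T r , localQueueNumber-3 T r
  where
  0F : Fin capacity
  0F = zero

theorem4 : ∃ λ n → ∃ λ (G : Graph n) → Treewidth G 2 × LocalQueueNumber G 3
theorem4 = rich-extension
  -- The start is a single edge, made by attaching a leaf to `K₁`; the depth 6 is the number of
  -- rounds in `strategy-wins`.
  (enrich (capacity * capacity) 6 {u = zero} {suc zero} (attach {u = zero} single (inj₁ refl)) tt)
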